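{- Let $\mathcal{M}_0$ be a dependent structure in a language $\mathcal{L}_0$, and let $\mathcal{M}$ be an arbitrary expansion of $\mathcal{M}_0$ in some language $\mathcal{L}\supseteq\mathcal{L}_0$. Let $\varphi(x_1,\ldots,x_d)$ be an $\mathcal{L}_0$-formula. Let $y_1,y_2,y_3$ be finite tuples of variables. For each $i\in\{1,\ldots,d\}$, fix some $s_i<t_i\in\{1,2,3\}$ and let $f_i:M_{y_{s_i}}\times M_{y_{t_i}}\to M_{x_i}$ be an $\mathcal{L}$-definable binary function. Then the $\mathcal{L}$-formula $$\psi(y_1;y_2,y_3):=\varphi\left(f_1(y_{s_1},y_{t_1}),\ldots,f_d(y_{s_d},y_{t_d})\right)$$ is $2$-dependent (with respect to $\mathrm{Th}_{\mathcal{L}}(\mathcal{M})$).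
   Context: All variables $x_i,y_j$ are allowed to be tuples of arbitrary finite length; for a tuple of variables $x$, $M_x$ denotes the corresponding product of sorts of $\mathcal{M}$. A partitioned formula $\varphi(x;y_1,\ldots,y_n)$ has the $n$-independence property with respect to a theory $T$ if in some model of $T$ there is a sequence of tuples $(a_{1,i},\ldots,a_{n,i})_{i\in\omega}$ such that for every $s\subseteq\omega^n$ there is a tuple $b_s$ with $\models\varphi(b_s;a_{1,i_1},\ldots,a_{n,i_n})\Leftrightarrow(i_1,\ldots,i_n)\in s$; otherwise it is $n$-dependent. A theory is $n$-dependent if every formula is $n$-dependent with respect to it; a structure is $n$-dependent if its theory is; "dependent" means $1$-dependent (NIP). -}

module Defs where

open import Level using (Level; 0ℓ) renaming (suc to lsuc)
open import Data.Empty.Polymorphic using (⊥)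
open import Data.Fin using (Fin; zero; suc)
open import Data.List using (List; []; _∷_; _++_; concat; tabulate; foldr)
open import Data.List.Membership.Propositional using (_∈_)
open import Data.List.Membership.Propositional.Properties using (∈-++⁺ˡ; ∈-++⁺ʳ; ∈-++⁻)
open import Data.List.Relation.Binary.Subset.Propositional using (_⊆_)
open import Data.List.Relation.Binary.Subset.Propositional.Properties
  using (∷⁺ʳ; xs⊆xs++ys; xs⊆ys++xs)
open import Data.List.Relation.Unary.All using (All; []; _∷_; lookup)
open import Data.List.Relation.Unary.All.Properties using (++⁺; concat⁺; tabulate⁺)
open import Data.Nat using (ℕ)
open import Data.Product using (Σ-syntax; _×_; _,_)
open import Data.Sum using ([_,_]′)
open import Data.Vec using (Vec) renaming (lookup to lookupᵛ)
open import Function using (_∘_; _↣_; _⇔_; Injection)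
open import Function.Construct.Identity using (↣-id)
open import Relation.Binary using (Setoid)
open import Relation.Binary.PropositionalEquality using (_≡_)
open import Relation.Nullary using (¬_)
open import Relation.Unary using (Pred)

-- Everything (symbols, domains, interpretations) lives in one universe
-- `Set ℓ`, which plays the role of the universe of sets: "some model of T"
-- ranges over the structures in `Set ℓ`.

record Language {ℓ : Level} (S : Set ℓ) : Set (lsuc ℓ) where
  field
    Fun : List S → S → Set ℓ
    Rel : List S → Set ℓ

open Language public

-- A tuple of variables is the list of its sorts; a variable of sort s in
-- scope Γ is a proof of s ∈ Γ.

data Term {ℓ : Level} {S : Set ℓ} (L : Language S) (Γ : List S) : S → Set ℓ where
  var : ∀ {s} → s ∈ Γ → Term L Γ s
  fun : ∀ {as s} → Fun L as s → All (Term L Γ) as → Term L Γ s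

infixr 6 _∧ᶠ_
infix  7 _≐_

data Formula {ℓ : Level} {S : Set ℓ} (L : Language S) (Γ : List S) : Set ℓ where
  ⊥ᶠ   : Formula L Γ
  _≐_  : ∀ {s} → Term L Γ s → Term L Γ s → Formula L Γ
  rel  : ∀ {as} → Rel L as → All (Term L Γ) as → Formula L Γ
  ¬ᶠ_  : Formula L Γ → Formula L Γ
  _∧ᶠ_ : Formula L Γ → Formula L Γ → Formula L Γ
  ∃ᶠ   : ∀ s → Formula L (s ∷ Γ) → Formula L Γ

Sentence : ∀ {ℓ} {S : Set ℓ} → Language S → Set ℓ
Sentence L = Formula L []

Theory : ∀ {ℓ} {S : Set ℓ} → Language S → Set (lsuc ℓ)
Theory {ℓ} L = Pred (Sentence L) ℓ

-- Domains are setoids, and `≐` is interpreted by the setoid equality, so that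
-- quotients of structures are again structures.

record Structure {ℓ : Level} {S : Set ℓ} (L : Language S) : Set (lsuc ℓ) where
  field
    Dom : S → Setoid ℓ ℓ

  ∣_∣ : S → Set ℓ
  ∣ s ∣ = Setoid.Carrier (Dom s)

  Tuple : List S → Set ℓ
  Tuple = All ∣_∣

  _≋_ : ∀ {Γ} → Tuple Γ → Tuple Γ → Set ℓ
  _≋_ {Γ} a b = ∀ {s} (v : s ∈ Γ) → Setoid._≈_ (Dom s) (lookup a v) (lookup b v)

  field
    funᴹ      : ∀ {as s} → Fun L as s → Tuple as → ∣ s ∣
    funᴹ-cong : ∀ {as s} (f : Fun L as s) {a b : Tuple as} →
                a ≋ b → Setoid._≈_ (Dom s) (funᴹ f a) (funᴹ f b)
    relᴹ      : ∀ {as} → Rel L as → Tuple as → Set ℓ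
    relᴹ-resp : ∀ {as} (R : Rel L as) {a b : Tuple as} →
                a ≋ b → relᴹ R a → relᴹ R b

open Structure public using (Dom; Tuple; funᴹ; relᴹ; funᴹ-cong; relᴹ-resp)

eval  : ∀ {ℓ} {S : Set ℓ} {L : Language S} (M : Structure L) {Γ s} →
        Term L Γ s → Tuple M Γ → Structure.∣_∣ M s
evals : ∀ {ℓ} {S : Set ℓ} {L : Language S} (M : Structure L) {Γ as} →
        All (Term L Γ) as → Tuple M Γ → Tuple M as
eval M (var v)    γ = lookup γ v
eval M (fun f ts) γ = funᴹ M f (evals M ts γ)
evals M []       γ = []
evals M (t ∷ ts) γ = eval M t γ ∷ evals M ts γ

infix 4 _⊨_[_] _⊨ᵀ_

_⊨_[_] : ∀ {ℓ} {S : Set ℓ} {L : Language S} (M : Structure L) {Γ} →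
         Formula L Γ → Tuple M Γ → Set ℓ
M ⊨ ⊥ᶠ            [ γ ] = ⊥
M ⊨ _≐_ {s} t u   [ γ ] = Setoid._≈_ (Dom M s) (eval M t γ) (eval M u γ)
M ⊨ rel R ts      [ γ ] = relᴹ M R (evals M ts γ)
M ⊨ ¬ᶠ φ          [ γ ] = ¬ (M ⊨ φ [ γ ])
M ⊨ φ ∧ᶠ χ        [ γ ] = (M ⊨ φ [ γ ]) × (M ⊨ χ [ γ ])
M ⊨ ∃ᶠ s φ        [ γ ] = Σ[ a ∈ Structure.∣_∣ M s ] (M ⊨ φ [ a ∷ γ ])

_⊨ᵀ_ : ∀ {ℓ} {S : Set ℓ} {L : Language S} → Structure L → Theory L → Set ℓ
M ⊨ᵀ T = ∀ σ → T σ → M ⊨ σ [ [] ]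

Th : ∀ {ℓ} {S : Set ℓ} {L : Language S} → Structure L → Theory L
Th M σ = M ⊨ σ [ [] ]

-- The scope of a family of tuples of variables z 0, …, z (k-1), and the
-- assignment to it of a family of tuples of elements.

Joint : ∀ {ℓ} {S : Set ℓ} {k} → (Fin k → List S) → List S
Joint z = concat (tabulate z)

join : ∀ {ℓ} {S : Set ℓ} {L : Language S} (M : Structure L) {k} {z : Fin k → List S} →
       (∀ i → Tuple M (z i)) → Tuple M (Joint z)
join M a = concat⁺ (tabulate⁺ a)

-- The scope of a formula partitioned as φ(x; y 0, …, y (n-1)) is x ++ Joint y.

HasIP : ∀ {ℓ} {S : Set ℓ} {L : Language S} (n : ℕ) → Theory L →
        (x : List S) (y : Fin n → List S) → Formula L (x ++ Joint y) → Set (lsuc ℓ)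
HasIP {L = L} n T x y φ =
  Σ[ N ∈ Structure L ] (N ⊨ᵀ T) ×
  Σ[ a ∈ (ℕ → ∀ k → Tuple N (y k)) ]
    (∀ (s : Pred (Vec ℕ n) 0ℓ) → Σ[ b ∈ Tuple N x ]
      (∀ (i : Vec ℕ n) →
        (N ⊨ φ [ ++⁺ b (join N λ k → a (lookupᵛ i k) k) ]) ⇔ s i))

IsDependentFormula : ∀ {ℓ} {S : Set ℓ} {L : Language S} (n : ℕ) → Theory L →
                     (x : List S) (y : Fin n → List S) →
                     Formula L (x ++ Joint y) → Set (lsuc ℓ)
IsDependentFormula n T x y φ = ¬ HasIP n T x y φ

IsDependentTheory : ∀ {ℓ} {S : Set ℓ} {L : Language S} (n : ℕ) → Theory L → Set (lsuc ℓ)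
IsDependentTheory n T = ∀ x y φ → IsDependentFormula n T x y φ

IsDependent : ∀ {ℓ} {S : Set ℓ} {L : Language S} → Structure L → Set (lsuc ℓ)
IsDependent M = IsDependentTheory 1 (Th M)

record _⊆ᴸ_ {ℓ : Level} {S : Set ℓ} (L₀ L : Language S) : Set ℓ where
  field
    onFun : ∀ {as s} → Fun L₀ as s ↣ Fun L as s
    onRel : ∀ {as} → Rel L₀ as ↣ Rel L as

open _⊆ᴸ_ public

reduct : ∀ {ℓ} {S : Set ℓ} {L₀ L : Language S} → L₀ ⊆ᴸ L → Structure L → Structure L₀
reduct ι M = record
  { Dom       = Dom M
  ; funᴹ      = λ f → funᴹ M (Injection.to (onFun ι) f)
  ; funᴹ-cong = λ f → funᴹ-cong M (Injection.to (onFun ι) f)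
  ; relᴹ      = λ R → relᴹ M (Injection.to (onRel ι) R)
  ; relᴹ-resp = λ R → relᴹ-resp M (Injection.to (onRel ι) R)
  }

IsExpansion : ∀ {ℓ} {S : Set ℓ} {L₀ L : Language S} →
              L₀ ⊆ᴸ L → Structure L → Structure L₀ → Set (lsuc ℓ)
IsExpansion ι M M₀ = reduct ι M ≡ M₀

mapTerm  : ∀ {ℓ} {S : Set ℓ} {L L′ : Language S} → L ⊆ᴸ L′ → ∀ {Γ Δ} → Γ ⊆ Δ →
           ∀ {s} → Term L Γ s → Term L′ Δ s
mapTerms : ∀ {ℓ} {S : Set ℓ} {L L′ : Language S} → L ⊆ᴸ L′ → ∀ {Γ Δ} → Γ ⊆ Δ →
           ∀ {as} → All (Term L Γ) as → All (Term L′ Δ) as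
mapTerm ι ρ (var v)    = var (ρ v)
mapTerm ι ρ (fun f ts) = fun (Injection.to (onFun ι) f) (mapTerms ι ρ ts)
mapTerms ι ρ []       = []
mapTerms ι ρ (t ∷ ts) = mapTerm ι ρ t ∷ mapTerms ι ρ ts

mapFormula : ∀ {ℓ} {S : Set ℓ} {L L′ : Language S} → L ⊆ᴸ L′ → ∀ {Γ Δ} → Γ ⊆ Δ →
             Formula L Γ → Formula L′ Δ
mapFormula ι ρ ⊥ᶠ         = ⊥ᶠ
mapFormula ι ρ (t ≐ u)    = mapTerm ι ρ t ≐ mapTerm ι ρ u
mapFormula ι ρ (rel R ts) = rel (Injection.to (onRel ι) R) (mapTerms ι ρ ts)
mapFormula ι ρ (¬ᶠ φ)     = ¬ᶠ mapFormula ι ρ φ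
mapFormula ι ρ (φ ∧ᶠ χ)   = mapFormula ι ρ φ ∧ᶠ mapFormula ι ρ χ
mapFormula ι ρ (∃ᶠ s φ)   = ∃ᶠ s (mapFormula ι (∷⁺ʳ s ρ) φ)

⊆ᴸ-refl : ∀ {ℓ} {S : Set ℓ} {L : Language S} → L ⊆ᴸ L
⊆ᴸ-refl = record { onFun = ↣-id _ ; onRel = ↣-id _ }

copair : ∀ {ℓ} {S : Set ℓ} {Γ Γ′ Δ : List S} → Γ ⊆ Δ → Γ′ ⊆ Δ → Γ ++ Γ′ ⊆ Δ
copair {Γ = Γ} ρ ρ′ v = [ ρ , ρ′ ]′ (∈-++⁻ Γ v)

component : ∀ {ℓ} {S : Set ℓ} {k} (z : Fin k → List S) (i : Fin k) → z i ⊆ Joint z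
component z zero    v = ∈-++⁺ˡ v
component z (suc i) v = ∈-++⁺ʳ (z zero) (component (z ∘ suc) i v)

-- Definable without parameters, so that substituting `graph` yields an L-formula.

record DefinableFunction {ℓ : Level} {S : Set ℓ} {L : Language S}
                         (M : Structure L) (u v w : List S) : Set ℓ where
  field
    apply   : Tuple M u → Tuple M v → Tuple M w
    graph   : Formula L (u ++ v ++ w)
    defines : ∀ a b c → (M ⊨ graph [ ++⁺ a (++⁺ b c) ]) ⇔ Structure._≋_ M (apply a b) c

open DefinableFunction public

∃* : ∀ {ℓ} {S : Set ℓ} {L : Language S} (Γ : List S) {Δ} →
     Formula L (Γ ++ Δ) → Formula L Δ
∃* []      φ = φ
∃* (s ∷ Γ) φ = ∃* Γ (∃ᶠ s φ)

-- φ(f₁(y_{s₁},y_{t₁}), …, f_d(y_{s_d},y_{t_d})), i.e.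
-- ∃ x₁ … x_d (⋀ᵢ fᵢ(y_{sᵢ},y_{tᵢ}) = xᵢ ∧ φ(x₁,…,x_d)).

substitute : ∀ {ℓ} {S : Set ℓ} {L₀ L : Language S} (ι : L₀ ⊆ᴸ L) (M : Structure L)
             {d m} (x : Fin d → List S) (y : Fin m → List S) (s t : Fin d → Fin m) →
             Formula L₀ (Joint x) →
             (∀ i → DefinableFunction M (y (s i)) (y (t i)) (x i)) →
             Formula L (Joint y)
substitute ι M x y s t φ f =
  let inX = xs⊆xs++ys (Joint x) (Joint y)
      inY = xs⊆ys++xs (Joint y) (Joint x)
  in
  ∃* (Joint x)
    (foldr _∧ᶠ_ (mapFormula ι inX φ)
      (tabulate λ i → mapFormula ⊆ᴸ-refl
        (copair (inY ∘ component y (s i))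
          (copair (inY ∘ component y (t i)) (inX ∘ component x i)))
        (graph (f i))))

module Submission where

-- By compactness (an ultrapower over ℕ), for an L₀-formula θ(v; w) some finite number of w's is
-- never shattered. Call finitely many formulas θ_c(v; w) proper if no (v, w) satisfies all of them.
-- For proper colours there is n such that every w₁, …, wₙ has a colouring E for which no v satisfies
-- θ_{E(i)}(v; wᵢ) for all i: eliminate one colour at a time, by cutting the w's into blocks of an
-- unshattered size for its formula.
--
-- Consequently the matrices (φ(uᵢ, vⱼ, wᵢⱼ)) with wᵢⱼ fixed and uᵢ, vⱼ arbitrary are not all the
-- n × m matrices: if m is an unshattered size for φ(u; v, w), then the 2ᵐ formulas
-- ∃u ⋀ⱼ φ(u, vⱼ, wⱼ)^{c(j)} are proper colours in v₁ … vₘ; w₁ … wₘ. A failure of 2-dependence gives,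
-- after transfer of a sentence to M, points b, aᵢ, a′ⱼ realising every n × m matrix, and
-- f(b, aᵢ), g(b, a′ⱼ), h(aᵢ, a′ⱼ) play the parts of uᵢ, vⱼ, wᵢⱼ.

open import Defs
open import Axiom.ExcludedMiddle using (ExcludedMiddle)
open import Axiom.Extensionality.Propositional using (Extensionality)
open import Data.Bool using (Bool; true; false; T; _∨_; if_then_else_)
open import Data.Bool.Properties using (T-∨)
open import Data.Empty using (⊥; ⊥-elim)
open import Data.Fin using (Fin; zero; suc; _<_; toℕ; fromℕ<; combine; remQuot; finToFun; funToFin)
open import Data.Fin.Properties
  using (toℕ-fromℕ<; toℕ-injective; remQuot-combine; finToFun-funToFin)
open import Data.List using (List; []; _∷_; _++_; foldr; tabulate)
open import Data.List.Membership.Propositional using (_∈_)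
open import Data.List.Membership.Propositional.Properties using (∈-++⁺ˡ; ∈-++⁺ʳ; ∈-++⁻)
open import Data.List.Relation.Binary.Subset.Propositional using (_⊆_)
open import Data.List.Relation.Binary.Subset.Propositional.Properties
  using (∷⁺ʳ; xs⊆xs++ys; xs⊆ys++xs)
open import Data.List.Relation.Unary.All as All using (All; []; _∷_; lookup)
open import Data.List.Relation.Unary.All.Properties using (++⁺; ++⁻ˡ; ++⁻ʳ; lookup-map)
open import Data.List.Relation.Unary.Any using (here; there)
import Data.List.Relation.Unary.Any.Properties as Any
open import Data.Nat using (ℕ; zero; suc; _≤_; s≤s; _⊔_; _*_; _^_; NonZero)
open import Data.Nat.Properties using (≤-refl; ≤-trans; m≤m⊔n; m≤n⊔m; m^n≢0)
open import Data.Product using (∃; Σ-syntax; ∃-syntax; _×_; _,_; proj₁; proj₂)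
open import Data.Sum using (_⊎_; inj₁; inj₂; [_,_]′)
open import Data.Unit using (tt)
open import Data.Vec using (Vec; []; _∷_)
open import Function using (_∘_; _⇔_; mk⇔; Equivalence)
open import Function.Construct.Composition using (_⇔-∘_)
open import Function.Construct.Symmetry using (⇔-sym)
open import Level using (Level; 0ℓ; Lift; lift; lower)
open import Relation.Binary using (Setoid)
open import Relation.Binary.PropositionalEquality using (_≡_; refl; sym; trans; cong; cong₂; subst)
open import Relation.Nullary using (¬_; Dec; yes; no; contradiction; isYes)
open import Relation.Nullary.Decidable using (decidable-stable; toWitness; fromWitness)
open import Relation.Unary using (Pred)

open Equivalence using (to; from)

-- Nonprincipal ultrafilters on ℕ.

record Ultrafilter (ℓ : Level) : Set (Level.suc ℓ) where
  field
    Large      : (ℕ → Set ℓ) → Set ℓ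
    -- Every cofinite set is large, so the ultrafilter is nonprincipal.
    eventually : ∀ {P} n → (∀ k → n ≤ k → P k) → Large P
    map        : ∀ {P Q} → (∀ {k} → P k → Q k) → Large P → Large Q
    both       : ∀ {P Q} → Large P → Large Q → Large (λ k → P k × Q k)
    complement : ∀ {P} → ¬ Large P → Large (λ k → ¬ P k)
    inhabited  : ∀ {P} → Large P → ∃ P

module Classical (em : ∀ {a} → ExcludedMiddle a) where

  stable : ∀ {a} {A : Set a} → ¬ ¬ A → A
  stable = decidable-stable em

  ¬∀⇒∃¬ : ∀ {a b} {A : Set a} {B : A → Set b} → ¬ (∀ x → B x) → ∃[ x ] ¬ B x
  ¬∀⇒∃¬ ¬all = stable λ none → ¬all λ x → stable λ ¬b → none (x , ¬b)

  ⌊_⌋ : ∀ {a} → Set a → Bool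
  ⌊ A ⌋ = isYes (em {P = A})

  ⌊⌋⁺ : ∀ {a} {A : Set a} → A → T ⌊ A ⌋
  ⌊⌋⁺ = fromWitness

  ⌊⌋⁻ : ∀ {a} {A : Set a} → T ⌊ A ⌋ → A
  ⌊⌋⁻ = toWitness

-- The Bourbaki–Witt argument: the families reachable from an inflationary
-- step by unions form a chain, so their union is closed under the step.
module Tower (em : ∀ {a} → ExcludedMiddle a) (ext : ∀ {a b} → Extensionality a b)
             {X : Set} (step : (X → Bool) → (X → Bool))
             (step-inflationary : ∀ F {x} → T (F x) → T (step F x)) where

  open Classical em

  -- Boolean-valued, so that arbitrary unions of families stay in the same universe and mutual
  -- inclusion yields equality.
  Family : Set
  Family = X → Bool

  infix 4 _⊑_
  _⊑_ : Family → Family → Set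
  F ⊑ G = ∀ x → T (F x) → T (G x)

  ⊑-antisym : ∀ {F G} → F ⊑ G → G ⊑ F → F ≡ G
  ⊑-antisym {F} {G} F⊑G G⊑F = ext λ x → T-injective (F x) (G x) (F⊑G x) (G⊑F x)
    where
    T-injective : ∀ b c → (T b → T c) → (T c → T b) → b ≡ c
    T-injective false false _ _ = refl
    T-injective false true  _ g = ⊥-elim (g tt)
    T-injective true  false f _ = ⊥-elim (f tt)
    T-injective true  true  _ _ = refl

  ⋃ : (Family → Bool) → Family
  ⋃ Q x = ⌊ (∃[ F ] T (Q F) × T (F x)) ⌋

  data Reachable : Family → Set where
    next  : ∀ {F} → Reachable F → Reachable (step F)
    union : ∀ Q → (∀ F → T (Q F) → Reachable F) → Reachable (⋃ Q)

  -- The extreme points of the Bourbaki-Witt proof: `compare` makes them comparable with everything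
  -- reachable, and `extreme` shows that everything reachable is one of them.
  Extreme : Family → Set
  Extreme F = ∀ {G} → Reachable G → G ⊑ F → ¬ (F ⊑ G) → step G ⊑ F

  -- Induction on the reachability of `G`. If `G ⊑ F`, extremity puts `step G` below `F`, unless `F`
  -- and `G` coincide, and then so do their steps. A union is above `step F` once a member is;
  -- otherwise all its members are below `F`.
  compare : ∀ {F G} → Extreme F → Reachable G → G ⊑ F ⊎ step F ⊑ G
  compare {F} ex (next {G} r) with compare ex r
  ... | inj₂ above = inj₂ λ x a → step-inflationary G (above x a)
  ... | inj₁ below with em {P = F ⊑ G}
  ...   | no  ¬F⊑G = inj₁ (ex r below ¬F⊑G)
  ...   | yes F⊑G  rewrite ⊑-antisym {F} {G} F⊑G below = inj₂ λ _ a → a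
  compare {F} ex (union Q r) with em {P = ∃[ G ] T (Q G) × step F ⊑ G}
  ... | yes (G , q , above) = inj₂ λ x a → ⌊⌋⁺ (G , q , above x a)
  ... | no  none = inj₁ λ x a → below x (⌊⌋⁻ a)
    where
    below : ∀ x → ∃[ G ] T (Q G) × T (G x) → T (F x)
    below x (G , q , g) with compare ex (r G q)
    ... | inj₁ G⊑F   = G⊑F x g
    ... | inj₂ above = contradiction (G , q , above) none

  extreme : ∀ {F} → Reachable F → Extreme F
  extreme (next {F} r) {G} s G⊑ ¬⊑G with compare (extreme r) s
  ... | inj₂ above = contradiction above ¬⊑G
  ... | inj₁ G⊑F with em {P = F ⊑ G}
  ...   | no  ¬F⊑G = λ x a → step-inflationary F (extreme r s G⊑F ¬F⊑G x a)
  ...   | yes F⊑G  rewrite ⊑-antisym {F} {G} F⊑G G⊑F = λ _ a → a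
  extreme (union Q r) {G} s G⊑ ¬⊑G = λ x a → ⌊⌋⁺ (F , q , below x a)
    where
    -- Some member of the union is not contained in `G`. It is extreme by induction and comparable
    -- with `G`, hence strictly above `G` and so above `step G`.
    notBelow : ∃[ F ] T (Q F) × ¬ (F ⊑ G)
    notBelow = stable λ none → ¬⊑G λ x a →
      let (F , q , f) = ⌊⌋⁻ a in stable λ ¬g → none (F , q , λ F⊑G → ¬g (F⊑G x f))
    F = proj₁ notBelow
    q = proj₁ (proj₂ notBelow)
    below : step G ⊑ F
    below with compare (extreme (r F q)) s
    ... | inj₁ G⊑F   = extreme (r F q) s G⊑F (proj₂ (proj₂ notBelow))
    ... | inj₂ above = contradiction (λ x f → above x (step-inflationary F f))
                                     (proj₂ (proj₂ notBelow))

  total : ∀ {F G} → Reachable F → Reachable G → F ⊑ G ⊎ G ⊑ F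
  total {F} r s with compare (extreme r) s
  ... | inj₁ G⊑F   = inj₂ G⊑F
  ... | inj₂ above = inj₁ λ x f → above x (step-inflationary F f)

  top : Family
  top = ⋃ λ F → ⌊ Reachable F ⌋

  top-reachable : Reachable top
  top-reachable = union _ λ F → ⌊⌋⁻

  top-closed : step top ⊑ top
  top-closed _ a = ⌊⌋⁺ (step top , ⌊⌋⁺ (next top-reachable) , a)

module UltrafilterExistence
  (em : ∀ {a} → ExcludedMiddle a) (ext : ∀ {a b} → Extensionality a b) where

  open Classical em

  ℙ : Set
  ℙ = ℕ → Bool

  Meet : List ℙ → ℕ → Set
  Meet As k = All (λ A → T (A k)) As

  -- The finite intersection property with unbounded meets instead of nonempty ones, so that
  -- cofinite sets can be added.
  Good : (ℙ → Bool) → Set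
  Good F = ∀ As → All (T ∘ F) As → ∀ n → ∃[ k ] n ≤ k × Meet As k

  adjoin : (ℙ → Bool) → ℙ → (ℙ → Bool)
  adjoin F A B = F B ∨ ⌊ B ≡ A ⌋

  Extendable : (ℙ → Bool) → Set
  Extendable F = ∃[ A ] ¬ T (F A) × Good (adjoin F A)

  -- Excluded middle acts as choice: a proof of `Extendable F` carries the set to adjoin. The
  -- decision is an argument so that proofs can split on it.
  grow : ∀ F → Dec (Extendable F) → ℙ → Bool
  grow F (yes (A , _)) = adjoin F A
  grow F (no _)        = F

  grow-inflationary : ∀ F d {B} → T (F B) → T (grow F d B)
  grow-inflationary F (yes _) b = from T-∨ (inj₁ b)
  grow-inflationary F (no _)  b = b

  open Tower em ext (λ F → grow F em) (λ F → grow-inflationary F em)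

  grow-good : ∀ F d → Good F → Good (grow F d)
  grow-good F (yes (_ , _ , good)) _    = good
  grow-good F (no _)               good = good

  reachable-good : ∀ {F} → Reachable F → Good F
  reachable-good (next {F} r) = grow-good F em (reachable-good r)
  -- Treated apart because `Q` may contain no family, as at the bottom of the tower.
  reachable-good (union Q r) [] [] n = n , ≤-refl , []
  reachable-good (union Q r) (A ∷ As) (a ∷ as) =
    let (F , q , all) = upperBound (A ∷ As) A (⌊⌋⁻ a) (a ∷ as)
    in reachable-good (r F q) (A ∷ As) all
    where
    -- The tower is a chain, so finitely many sets of the union lie in one member; `B` supplies that
    -- member when the list is empty.
    upperBound : ∀ Bs B → ∃[ F ] T (Q F) × T (F B) → All (T ∘ ⋃ Q) Bs →
                 ∃[ F ] T (Q F) × All (T ∘ F) Bs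
    upperBound [] B (F , q , _) [] = F , q , []
    upperBound (C ∷ Bs) B b (c ∷ bs) with upperBound Bs B b bs | ⌊⌋⁻ c
    ... | F , q , all | G , q′ , g with total (r F q) (r G q′)
    ...   | inj₁ F⊑G = G , q′ , g ∷ All.map (F⊑G _) all
    ...   | inj₂ G⊑F = F , q , G⊑F _ g ∷ all

  top-good : Good top
  top-good = reachable-good top-reachable

  unextendable : ¬ Extendable top
  unextendable e = contra em top-closed
    where
    contra : (d : Dec (Extendable top)) → ¬ (grow top d ⊑ top)
    contra (no ¬e)          _      = ¬e e
    contra (yes (A , ¬a , _)) closed = ¬a (closed A (from T-∨ (inj₂ (⌊⌋⁺ refl))))

  unadjoin : ∀ {F A} Bs → All (T ∘ adjoin F A) Bs →
             ∃[ Cs ] All (T ∘ F) Cs × (∀ {k} → T (A k) → Meet Cs k → Meet Bs k)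
  unadjoin [] [] = [] , [] , λ _ _ → []
  unadjoin {F} {A} (B ∷ Bs) (b ∷ bs) with unadjoin Bs bs | to (T-∨ {F B}) b
  ... | Cs , all , meet | inj₁ f = B ∷ Cs , f ∷ all , λ { a (b ∷ cs) → b ∷ meet a cs }
  ... | Cs , all , meet | inj₂ e with ⌊⌋⁻ e
  ...   | refl = Cs , all , λ a cs → a ∷ meet a cs

  -- Maximality of `top`: adjoining `A` breaks goodness, so some finite meet is bounded once `A` may
  -- take part in it, and `unadjoin` leaves only sets of `top` besides `A`.
  refute : ∀ {A} → ¬ T (top A) →
           ∃[ As ] All (T ∘ top) As × ∃[ n ] (∀ k → n ≤ k → Meet As k → ¬ T (A k))
  refute {A} ¬a =
    let (Bs , h)       = ¬∀⇒∃¬ λ good → unextendable (A , ¬a , good)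
        (bs , h′)      = ¬∀⇒∃¬ h
        (n , disjoint) = ¬∀⇒∃¬ h′
        (As , as , meet) = unadjoin Bs bs
    in As , as , n , λ k n≤k m a → disjoint (k , n≤k , meet a m)

  -- If `B` were missing, `refute` would give a meet that avoids `B` from some point on, yet its
  -- meet with `As` is unbounded. Cofinite sets, supersets and binary meets are all instances.
  top-upward : ∀ {As B} n → All (T ∘ top) As → (∀ k → n ≤ k → Meet As k → T (B k)) → T (top B)
  top-upward {As} n as sub = stable λ ¬b →
    let (Bs , bs , n′ , disjoint) = refute ¬b
        (k , le , m) = top-good (As ++ Bs) (++⁺ as bs) (n ⊔ n′)
    in disjoint k (≤-trans (m≤n⊔m n n′) le) (++⁻ʳ As m)
         (sub k (≤-trans (m≤m⊔n n n′) le) (++⁻ˡ As m))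

  ultrafilter : ∀ ℓ → Ultrafilter ℓ
  ultrafilter ℓ = record
    { Large      = λ P → Lift ℓ (T (top λ k → ⌊ P k ⌋))
    ; eventually = λ n p → lift (top-upward n [] λ k n≤k _ → ⌊⌋⁺ (p k n≤k))
    ; map        = λ { f (lift p) → lift (top-upward 0 (p ∷ []) λ { k _ (a ∷ []) → ⌊⌋⁺ (f (⌊⌋⁻ a)) }) }
    ; both       = λ { (lift p) (lift q) → lift (top-upward 0 (p ∷ q ∷ [])
                     λ { k _ (a ∷ b ∷ []) → ⌊⌋⁺ (⌊⌋⁻ a , ⌊⌋⁻ b) }) }
    ; complement = λ ¬p → let (As , as , n , disjoint) = refute (¬p ∘ lift) in
                     lift (top-upward n as λ k n≤k m → ⌊⌋⁺ λ p → disjoint k n≤k m (⌊⌋⁺ p))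
    ; inhabited  = λ { (lift p) → inh (top-good (_ ∷ []) (p ∷ []) 0) }
    }
    where
    inh : ∀ {P : ℕ → Set ℓ} → ∃[ k ] 0 ≤ k × Meet ((λ k → ⌊ P k ⌋) ∷ []) k → ∃ P
    inh (k , _ , a ∷ []) = k , ⌊⌋⁻ a

-- Tuples, changes of scope and satisfaction.

module _ {a p} {A : Set a} {P : A → Set p} where

  lookup-++⁺ : ∀ {xs ys} (as : All P xs) (bs : All P ys) {x} (v : x ∈ xs ++ ys) →
               lookup (++⁺ as bs) v ≡ [ lookup as , lookup bs ]′ (∈-++⁻ xs v)
  lookup-++⁺ []       bs v           = refl
  lookup-++⁺ (a ∷ as) bs (here refl) = refl
  lookup-++⁺ {x ∷ xs} (a ∷ as) bs (there v) with ∈-++⁻ xs v | lookup-++⁺ as bs v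
  ... | inj₁ _ | eq = eq
  ... | inj₂ _ | eq = eq

  lookup-++⁺ˡ : ∀ {xs ys} (as : All P xs) (bs : All P ys) {x} (v : x ∈ xs) →
                lookup (++⁺ as bs) (∈-++⁺ˡ v) ≡ lookup as v
  lookup-++⁺ˡ (a ∷ as) bs (here refl) = refl
  lookup-++⁺ˡ (a ∷ as) bs (there v)   = lookup-++⁺ˡ as bs v

  lookup-++⁺ʳ : ∀ {xs ys} (as : All P xs) (bs : All P ys) {x} (v : x ∈ ys) →
                lookup (++⁺ as bs) (∈-++⁺ʳ xs v) ≡ lookup bs v
  lookup-++⁺ʳ []       bs v = refl
  lookup-++⁺ʳ (a ∷ as) bs v = lookup-++⁺ʳ as bs v

  lookup-tabulate : ∀ {xs} (f : ∀ {x} → x ∈ xs → P x) {x} (v : x ∈ xs) →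
                    lookup (All.tabulate f) v ≡ f v
  lookup-tabulate f (here refl) = refl
  lookup-tabulate f (there v)   = lookup-tabulate (f ∘ there) v

module _ {ℓ} {S : Set ℓ} where

  locate : ∀ {k} (z : Fin k → List S) {s} (v : s ∈ Joint z) →
           ∃[ i ] Σ[ u ∈ s ∈ z i ] component z i u ≡ v
  locate {zero}  z ()
  locate {suc k} z v with ∈-++⁻ (z zero) v | Any.++⁺∘++⁻ (z zero) v
  ... | inj₁ u | eq = zero , u , eq
  ... | inj₂ w | eq with locate (z ∘ suc) w
  ...   | i , u , refl = suc i , u , eq

module _ {ℓ} {S : Set ℓ} {L : Language S} where

  ⋀ : ∀ {k Γ} → (Fin k → Formula L Γ) → Formula L Γ
  ⋀ φ = foldr _∧ᶠ_ (¬ᶠ ⊥ᶠ) (tabulate φ)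

  literal : ∀ {Γ} → Bool → Formula L Γ → Formula L Γ
  literal true  φ = φ
  literal false φ = ¬ᶠ φ

  rename : ∀ {Γ Δ} → Δ ⊆ Γ → Formula L Δ → Formula L Γ
  rename = mapFormula ⊆ᴸ-refl

module Semantics {ℓ} {S : Set ℓ} {L : Language S} (M : Structure L) where

  infix 4 _≈_
  _≈_ : ∀ {s} → Structure.∣_∣ M s → Structure.∣_∣ M s → Set ℓ
  _≈_ {s} = Setoid._≈_ (Dom M s)

  module ≈ {s} = Setoid (Dom M s)

  -- Agreement is up to setoid equality, since a graph fixes the value of a definable function only
  -- so far. A change of scope is handled by building such agreement piecewise and applying
  -- `satisfies-map`.
  record Restricts {Γ Δ} (ρ : Δ ⊆ Γ) (γ : Tuple M Γ) (δ : Tuple M Δ) : Set ℓ where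
    constructor restricts
    field
      agree : ∀ {s} (v : s ∈ Δ) → lookup γ (ρ v) ≈ lookup δ v

  open Restricts

  restricts-∘ : ∀ {Γ Δ Θ} {ρ : Δ ⊆ Γ} {σ : Θ ⊆ Δ} {γ δ θ} →
                Restricts ρ γ δ → Restricts σ δ θ → Restricts (ρ ∘ σ) γ θ
  restricts-∘ {σ = σ} p q = restricts λ v → ≈.trans (agree p (σ v)) (agree q v)

  restricts-left : ∀ {Γ Δ} (γ : Tuple M Γ) (δ : Tuple M Δ) →
                   Restricts (xs⊆xs++ys Γ Δ) (++⁺ γ δ) γ
  restricts-left γ δ = restricts λ v → ≈.reflexive (lookup-++⁺ˡ γ δ v)

  restricts-right : ∀ {Γ Δ} (γ : Tuple M Γ) (δ : Tuple M Δ) →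
                    Restricts (xs⊆ys++xs Δ Γ) (++⁺ γ δ) δ
  restricts-right γ δ = restricts λ v → ≈.reflexive (lookup-++⁺ʳ γ δ v)

  restricts-copair : ∀ {Γ Δ Δ′} {ρ : Δ ⊆ Γ} {ρ′ : Δ′ ⊆ Γ} {γ δ δ′} →
                     Restricts ρ γ δ → Restricts ρ′ γ δ′ →
                     Restricts (copair {Γ = Δ} {Γ′ = Δ′} ρ ρ′) γ (++⁺ δ δ′)
  restricts-copair {Δ = Δ} {Δ′} {ρ} {ρ′} {γ} {δ} {δ′} p p′ =
    restricts λ v → ≈.trans (cases (∈-++⁻ Δ v)) (≈.reflexive (sym (lookup-++⁺ δ δ′ v)))
    where
    cases : ∀ {s} (w : s ∈ Δ ⊎ s ∈ Δ′) →
            lookup γ ([ ρ , ρ′ ]′ w) ≈ [ lookup δ , lookup δ′ ]′ w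
    cases (inj₁ u) = agree p u
    cases (inj₂ u) = agree p′ u

  restricts-component : ∀ {k} {z : Fin k → List S} (c : ∀ i → Tuple M (z i)) i →
                        Restricts (component z i) (join M c) (c i)
  restricts-component c zero    = restricts-left (c zero) (join M (c ∘ suc))
  restricts-component c (suc i) =
    restricts-∘ (restricts-right (c zero) (join M (c ∘ suc))) (restricts-component (c ∘ suc) i)

  restricts-join : ∀ {k Γ} {z : Fin k → List S} (ρ : Joint z ⊆ Γ) {γ} (c : ∀ i → Tuple M (z i)) →
                   (∀ i → Restricts (ρ ∘ component z i) γ (c i)) → Restricts ρ γ (join M c)
  restricts-join {z = z} ρ {γ} c p = restricts locally
    where
    locally : ∀ {s} (v : s ∈ Joint z) → lookup γ (ρ v) ≈ lookup (join M c) v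
    locally v with locate z v
    ... | i , u , refl = ≈.trans (agree (p i) u) (≈.sym (agree (restricts-component c i) u))

  restrict : ∀ {Γ Δ} → Δ ⊆ Γ → Tuple M Γ → Tuple M Δ
  restrict ρ γ = All.tabulate (λ v → lookup γ (ρ v))

  restricts-restrict : ∀ {Γ Δ} (ρ : Δ ⊆ Γ) γ → Restricts ρ γ (restrict ρ γ)
  restricts-restrict ρ γ = restricts λ v → ≈.reflexive (sym (lookup-tabulate (λ v → lookup γ (ρ v)) v))

  satisfies-∃* : ∀ Γ {Δ} (φ : Formula L (Γ ++ Δ)) {δ} →
                 (M ⊨ ∃* Γ φ [ δ ]) ⇔ (Σ[ γ ∈ Tuple M Γ ] M ⊨ φ [ ++⁺ γ δ ])
  satisfies-∃* []      φ = mk⇔ (λ p → [] , p) λ { ([] , p) → p }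
  satisfies-∃* (s ∷ Γ) φ = mk⇔
    (λ p → let (γ , a , q) = to (satisfies-∃* Γ (∃ᶠ s φ)) p in a ∷ γ , q)
    (λ { (a ∷ γ , q) → from (satisfies-∃* Γ (∃ᶠ s φ)) (γ , a , q) })

  -- The end `χ` is kept general: it is truth in `⋀` and the formula `φ` in `substitute`.
  satisfies-foldr : ∀ {k Γ} (φ : Fin k → Formula L Γ) χ {γ} →
                    (M ⊨ foldr _∧ᶠ_ χ (tabulate φ) [ γ ]) ⇔
                    ((∀ i → M ⊨ φ i [ γ ]) × (M ⊨ χ [ γ ]))
  satisfies-foldr {zero}  φ χ = mk⇔ (λ p → (λ ()) , p) proj₂
  satisfies-foldr {suc k} φ χ = mk⇔
    (λ (p , q) → let (ps , r) = to (satisfies-foldr (φ ∘ suc) χ) q in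
       (λ { zero → p ; (suc i) → ps i }) , r)
    (λ (ps , r) → ps zero , from (satisfies-foldr (φ ∘ suc) χ) (ps ∘ suc , r))

  satisfies-⋀ : ∀ {k Γ} (φ : Fin k → Formula L Γ) {γ} →
                (M ⊨ ⋀ φ [ γ ]) ⇔ (∀ i → M ⊨ φ i [ γ ])
  satisfies-⋀ φ = mk⇔ (proj₁ ∘ to (satisfies-foldr φ _))
                      (λ p → from (satisfies-foldr φ _) (p , λ ()))

  satisfies-literal : ∀ b {Γ} (φ : Formula L Γ) {γ} →
                      (M ⊨ literal b φ [ γ ]) ⇔ ((M ⊨ φ [ γ ]) ⇔ T b)
  satisfies-literal true  φ = mk⇔ (λ p → mk⇔ _ (λ _ → p)) (λ e → from e tt)
  satisfies-literal false φ = mk⇔ (λ ¬p → mk⇔ (λ p → ¬p p) λ ()) to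

  module _ {L₀ : Language S} (ι : L₀ ⊆ᴸ L) {Γ Δ : List S} (ρ : Δ ⊆ Γ) where

    eval-mapTerm : ∀ {γ δ} → Restricts ρ γ δ → ∀ {s} (t : Term L₀ Δ s) →
                   eval M (mapTerm ι ρ t) γ ≈ eval (reduct ι M) t δ
    evals-mapTerms : ∀ {γ δ} → Restricts ρ γ δ → ∀ {as} (ts : All (Term L₀ Δ) as) →
                     Structure._≋_ M (evals M (mapTerms ι ρ ts) γ) (evals (reduct ι M) ts δ)
    eval-mapTerm p (var v)    = agree p v
    eval-mapTerm p (fun f ts) = funᴹ-cong M _ (evals-mapTerms p ts)
    evals-mapTerms p (t ∷ ts) (here refl) = eval-mapTerm p t
    evals-mapTerms p (t ∷ ts) (there v)   = evals-mapTerms p ts v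

  restricts-∷ : ∀ {Γ Δ s} {ρ : Δ ⊆ Γ} {γ δ} (a : Structure.∣_∣ M s) →
                Restricts ρ γ δ → Restricts (∷⁺ʳ s ρ) (a ∷ γ) (a ∷ δ)
  restricts-∷ a p = restricts λ { (here refl) → ≈.refl ; (there v) → agree p v }

  satisfies-map : ∀ {L₀ : Language S} (ι : L₀ ⊆ᴸ L) {Γ Δ} (ρ : Δ ⊆ Γ) (φ : Formula L₀ Δ) {γ δ} →
                  Restricts ρ γ δ → (M ⊨ mapFormula ι ρ φ [ γ ]) ⇔ (reduct ι M ⊨ φ [ δ ])
  satisfies-map ι ρ ⊥ᶠ p = mk⇔ (λ ()) (λ ())
  satisfies-map ι ρ (t ≐ u) p = mk⇔
    (λ e → ≈.trans (≈.sym (eval-mapTerm ι ρ p t)) (≈.trans e (eval-mapTerm ι ρ p u)))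
    (λ e → ≈.trans (eval-mapTerm ι ρ p t) (≈.trans e (≈.sym (eval-mapTerm ι ρ p u))))
  satisfies-map ι ρ (rel R ts) p = mk⇔
    (relᴹ-resp M _ (evals-mapTerms ι ρ p ts))
    (relᴹ-resp M _ λ v → ≈.sym (evals-mapTerms ι ρ p ts v))
  satisfies-map ι ρ (¬ᶠ φ) p = mk⇔ (λ ¬q → ¬q ∘ from (satisfies-map ι ρ φ p))
                                   (λ ¬q → ¬q ∘ to (satisfies-map ι ρ φ p))
  satisfies-map ι ρ (φ ∧ᶠ χ) p = mk⇔
    (λ (q , r) → to (satisfies-map ι ρ φ p) q , to (satisfies-map ι ρ χ p) r)
    (λ (q , r) → from (satisfies-map ι ρ φ p) q , from (satisfies-map ι ρ χ p) r)
  satisfies-map ι ρ (∃ᶠ s φ) p = mk⇔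
    (λ (a , q) → a , to (satisfies-map ι (∷⁺ʳ s ρ) φ (restricts-∷ a p)) q)
    (λ (a , q) → a , from (satisfies-map ι (∷⁺ʳ s ρ) φ (restricts-∷ a p)) q)

  satisfies-rename : ∀ {Γ Δ} (ρ : Δ ⊆ Γ) (φ : Formula L Δ) {γ δ} →
                     Restricts ρ γ δ → (M ⊨ rename ρ φ [ γ ]) ⇔ (M ⊨ φ [ δ ])
  satisfies-rename = satisfies-map ⊆ᴸ-refl

-- Ultrapowers and Łoś's theorem.

module Ultrapower (em : ∀ {a} → ExcludedMiddle a) {ℓ} (U : Ultrafilter ℓ)
                  {S : Set ℓ} {L : Language S} (A : Structure L) where

  open Classical em
  open Ultrafilter U
  open Semantics A using (_≈_; module ≈)

  Sequence : S → Set ℓ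
  Sequence s = ℕ → Structure.∣_∣ A s

  at : ∀ {Γ} → ℕ → All Sequence Γ → Tuple A Γ
  at n = All.map (λ g → g n)

  largely-≋ : ∀ {Γ} (γ δ : All Sequence Γ) →
              (∀ {s} (v : s ∈ Γ) → Large λ n → lookup γ v n ≈ lookup δ v n) →
              Large λ n → Structure._≋_ A (at n γ) (at n δ)
  largely-≋ []      []      h = eventually 0 λ _ _ ()
  largely-≋ (g ∷ γ) (d ∷ δ) h =
    map (λ { (p , q) (here refl) → p ; (p , q) (there v) → q v })
        (both (h (here refl)) (largely-≋ γ δ (h ∘ there)))

  always : ∀ {P} → (∀ n → P n) → Large P
  always p = eventually 0 λ n _ → p n

  power : Structure L
  power = record
    { Dom       = λ s → record
      { Carrier       = Sequence s
      ; _≈_           = λ g h → Large λ n → g n ≈ h n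
      ; isEquivalence = record
        { refl  = always λ _ → ≈.refl
        ; sym   = map ≈.sym
        ; trans = λ p q → map (λ (p , q) → ≈.trans p q) (both p q)
        }
      }
    ; funᴹ      = λ f γ n → funᴹ A f (at n γ)
    ; funᴹ-cong = λ f {γ} {δ} h → map (funᴹ-cong A f) (largely-≋ γ δ h)
    ; relᴹ      = λ R γ → Large λ n → relᴹ A R (at n γ)
    ; relᴹ-resp = λ R {γ} {δ} h p → map (λ (e , r) → relᴹ-resp A R e r) (both (largely-≋ γ δ h) p)
    }

  eval-at : ∀ {Γ s} (t : Term L Γ s) γ n → eval power t γ n ≡ eval A t (at n γ)
  evals-at : ∀ {Γ as} (ts : All (Term L Γ) as) γ n → at n (evals power ts γ) ≡ evals A ts (at n γ)
  eval-at (var v)    γ n = sym (lookup-map γ v)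
  eval-at (fun f ts) γ n = cong (funᴹ A f) (evals-at ts γ n)
  evals-at []       γ n = refl
  evals-at (t ∷ ts) γ n = cong₂ _∷_ (eval-at t γ n) (evals-at ts γ n)

  Łoś : ∀ {Γ} (φ : Formula L Γ) {γ} → (power ⊨ φ [ γ ]) ⇔ Large (λ n → A ⊨ φ [ at n γ ])
  Łoś ⊥ᶠ = mk⇔ (λ ()) (λ p → proj₂ (inhabited p))
  Łoś (t ≐ u) {γ} = mk⇔
    (map λ {n} e → ≈.trans (≈.reflexive (sym (eval-at t γ n))) (≈.trans e (≈.reflexive (eval-at u γ n))))
    (map λ {n} e → ≈.trans (≈.reflexive (eval-at t γ n)) (≈.trans e (≈.reflexive (sym (eval-at u γ n)))))
  Łoś (rel R ts) {γ} = mk⇔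
    (map λ {n} → subst (relᴹ A R) (evals-at ts γ n))
    (map λ {n} → subst (relᴹ A R) (sym (evals-at ts γ n)))
  Łoś (¬ᶠ φ) = mk⇔
    (λ ¬p → complement (¬p ∘ from (Łoś φ)))
    (λ ¬p p → let (_ , ¬q , q) = inhabited (both ¬p (to (Łoś φ) p)) in ¬q q)
  Łoś (φ ∧ᶠ χ) = mk⇔
    (λ (p , q) → both (to (Łoś φ) p) (to (Łoś χ) q))
    (λ p → from (Łoś φ) (map proj₁ p) , from (Łoś χ) (map proj₂ p))
  Łoś (∃ᶠ s φ) {γ} = mk⇔
    (λ (g , p) → map (λ {n} q → g n , q) (to (Łoś φ) p))
    -- Indices without a witness need a default value. Sorts may be empty, so it is taken from some
    -- index where a witness exists.
    (λ p → let g = λ n → witness (proj₁ (proj₂ (inhabited p))) n em in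
      g , from (Łoś φ) (map (λ {n} q → witnessed _ n em q) p))
    where
    Witness : ℕ → Set ℓ
    Witness n = Σ[ a ∈ Structure.∣_∣ A s ] A ⊨ φ [ a ∷ at n γ ]
    witness : Structure.∣_∣ A s → ∀ n → Dec (Witness n) → Structure.∣_∣ A s
    witness d n (yes (a , _)) = a
    witness d n (no _)        = d
    witnessed : ∀ d n w → Witness n → A ⊨ φ [ witness d n w ∷ at n γ ]
    witnessed d n (yes (_ , p)) _ = p
    witnessed d n (no ¬w)       w = contradiction w ¬w

  power-⊨ᵀ : power ⊨ᵀ Th A
  power-⊨ᵀ σ p = from (Łoś σ) (always λ _ → p)

  bundle : ∀ {Γ} → (ℕ → Tuple A Γ) → Tuple power Γ
  bundle {[]}    g = []
  bundle {s ∷ Γ} g = (All.head ∘ g) ∷ bundle (All.tail ∘ g)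

  at-bundle-++⁺ : ∀ {Γ Δ} (g : ℕ → Tuple A Γ) (h : ℕ → Tuple A Δ) n →
                  at n (++⁺ (bundle g) (bundle h)) ≡ ++⁺ (g n) (h n)
  at-bundle-++⁺ {[]} {[]} g h n with g n | h n
  ... | [] | [] = refl
  at-bundle-++⁺ {[]} {_ ∷ _} g h n with g n | h n | at-bundle-++⁺ g (All.tail ∘ h) n
  ... | [] | _ ∷ _ | eq = cong (_ ∷_) eq
  at-bundle-++⁺ {_ ∷ _} g h n with g n | at-bundle-++⁺ (All.tail ∘ g) h n
  ... | _ ∷ _ | eq = cong (_ ∷_) eq

-- Compactness for dependent formulas.

module FiniteShattering (em : ∀ {a} → ExcludedMiddle a) (ext : ∀ {a b} → Extensionality a b)
                {ℓ} {S : Set ℓ} {L : Language S} (A : Structure L) where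

  open Classical em
  open Semantics A

  Traces : ∀ V W (θ : Formula L (V ++ W)) {p} → Tuple A V → (Fin p → Tuple A W) → (Fin p → Bool) → Set ℓ
  Traces V W θ v w s = ∀ i → (A ⊨ θ [ ++⁺ v (w i) ]) ⇔ T (s i)

  fetch : ∀ {a} {B : Set a} {p} → (Fin p → B) → B → ℕ → B
  fetch {p = zero}  w d _       = d
  fetch {p = suc p} w d zero    = w zero
  fetch {p = suc p} w d (suc i) = fetch (w ∘ suc) d i

  fetch-toℕ : ∀ {a} {B : Set a} {p} (w : Fin p → B) d i → fetch w d (toℕ i) ≡ w i
  fetch-toℕ w d zero    = refl
  fetch-toℕ w d (suc i) = fetch-toℕ (w ∘ suc) d i

  -- `HasIP` takes its parameters in a `Joint`, which for a single tuple is `W ++ []` rather than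
  -- `W`.
  partition : ∀ V W → Formula L (V ++ W) → Formula L (V ++ Joint {k = 1} (λ _ → W))
  partition V W = rename
    (copair {Γ = V} {W} (xs⊆xs++ys V (W ++ [])) (xs⊆ys++xs (W ++ []) V ∘ xs⊆xs++ys W []))

  -- Realising the configurations of all finite sizes simultaneously in an ultrapower.
  shatters⇒IP : ∀ V W (θ : Formula L (V ++ W)) →
    (∀ p → Σ[ w ∈ (Fin p → Tuple A W) ] ∀ s → ∃[ v ] Traces V W θ v w s) →
    HasIP 1 (Th A) V (λ _ → W) (partition V W θ)
  shatters⇒IP V W θ shatters =
    power , power-⊨ᵀ , (λ i _ → bundle (g i)) , λ P → bundle (h P) , λ { (i ∷ []) → realises P i }
    where
    open Ultrapower em (UltrafilterExistence.ultrafilter em ext ℓ) A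
    open Ultrafilter (UltrafilterExistence.ultrafilter em ext ℓ)
    module P = Semantics power

    -- Coordinate `n` has only `n` parameters, and `d` fills the indices from `n` on. For fixed `i`
    -- this concerns finitely many `n`, a set that is not large.
    d : Tuple A W
    d = proj₁ (shatters 1) zero
    w : ∀ p → Fin p → Tuple A W
    w p = proj₁ (shatters p)
    g : ℕ → ℕ → Tuple A W
    g i n = fetch (w n) d i
    s : Pred (Vec ℕ 1) 0ℓ → ∀ {p} → Fin p → Bool
    s P i = ⌊ P (toℕ i ∷ []) ⌋
    h : Pred (Vec ℕ 1) 0ℓ → ℕ → Tuple A V
    h P n = proj₁ (proj₂ (shatters n) (s P))

    eventually-realises : ∀ P i n → suc i ≤ n → (A ⊨ θ [ ++⁺ (h P n) (g i n) ]) ⇔ P (i ∷ [])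
    eventually-realises P i n i<n rewrite sym (toℕ-fromℕ< i<n) | fetch-toℕ (w n) d (fromℕ< i<n) =
      mk⇔ ⌊⌋⁻ ⌊⌋⁺ ⇔-∘ proj₂ (proj₂ (shatters n) (s P)) (fromℕ< i<n)

    Łoś-θ : ∀ P i → (power ⊨ θ [ ++⁺ (bundle (h P)) (bundle (g i)) ]) ⇔
                    Large (λ n → A ⊨ θ [ ++⁺ (h P n) (g i n) ])
    Łoś-θ P i = mk⇔
      (map (λ {n} → subst (A ⊨ θ [_]) (at-bundle-++⁺ (h P) (g i) n)) ∘ to (Łoś θ))
      (from (Łoś θ) ∘ map (λ {n} → subst (A ⊨ θ [_]) (sym (at-bundle-++⁺ (h P) (g i) n))))

    realises : ∀ P i → _
    realises P i =
      -- A large set meets the tail beyond `i`, where the `i`-th parameter is a genuine one.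
      mk⇔ (λ p → let (n , q , i<n) = inhabited (both p (eventually (suc i) (λ n → lift {ℓ = ℓ}))) in
             to (eventually-realises P i n (lower i<n)) q)
          (λ p → eventually (suc i) λ n i<n → from (eventually-realises P i n i<n) p)
      ⇔-∘ (Łoś-θ P i ⇔-∘ P.satisfies-rename _ θ
        (P.restricts-copair
          (P.restricts-left (bundle (h P)) _)
          (P.restricts-∘ (P.restricts-right (bundle (h P)) _) (P.restricts-left (bundle (g i)) []))))

  abstract
    -- Contrapositive of `shatters⇒IP`: at some size no family is shattered, and each unshattered
    -- family misses a set.
    unshattered : IsDependent A → ∀ V W (θ : Formula L (V ++ W)) →
      ∃[ p ] ∀ (w : Fin p → Tuple A W) → ∃[ s ] ∀ v → ¬ Traces V W θ v w s
    unshattered nip V W θ = stable λ none → nip V (λ _ → W) (partition V W θ) (shatters⇒IP V W θ λ p →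
      let (w , h) = ¬∀⇒∃¬ (λ h → none (p , h)) in
      w , λ s → stable λ no → h (s , λ v t → no (v , t)))

-- Avoidable colourings and unrealised matrices.

Repeat : ∀ {ℓ} {S : Set ℓ} → ℕ → List S → List S
Repeat p W = Joint {k = p} (λ _ → W)

isOne : Fin 2 → Bool
isOne zero       = false
isOne (suc zero) = true

fromBool : Bool → Fin 2
fromBool false = zero
fromBool true  = suc zero

isOne-fromBool : ∀ b → isOne (fromBool b) ≡ b
isOne-fromBool false = refl
isOne-fromBool true  = refl

-- Subsets of `Fin m` are coded by binary digits as numbers below `2 ^ m`, so that they can index
-- finitely many colours.
bit : ∀ {m} → Fin (2 ^ m) → Fin m → Bool
bit c j = isOne (finToFun c j)

encode : ∀ {m} → (Fin m → Bool) → Fin (2 ^ m)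
encode s = funToFin (fromBool ∘ s)

bit-encode : ∀ {m} (s : Fin m → Bool) j → bit (encode s) j ≡ s j
bit-encode s j = trans (cong isOne (finToFun-funToFin (fromBool ∘ s) j)) (isOne-fromBool (s j))

module Dependent (em : ∀ {a} → ExcludedMiddle a) (ext : ∀ {a b} → Extensionality a b)
                 {ℓ} {S : Set ℓ} {L : Language S} (A : Structure L) (nip : IsDependent A) where

  open Classical em
  open Semantics A
  open FiniteShattering em ext A

  slot : ∀ (V W : List S) {p} → Fin p → V ++ W ⊆ V ++ Repeat p W
  slot V W {p} q = copair {Γ = V} {W}
    (xs⊆xs++ys V (Repeat p W)) (xs⊆ys++xs (Repeat p W) V ∘ component (λ _ → W) q)

  restricts-slot : ∀ {V W p} {q : Fin p} (v : Tuple A V) {ω} {w : Tuple A W} →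
                   Restricts (component (λ _ → W) q) ω w →
                   Restricts (slot V W q) (++⁺ v ω) (++⁺ v w)
  restricts-slot v {ω} r = restricts-copair (restricts-left v ω) (restricts-∘ (restricts-right v ω) r)

  -- Eliminates the colour of θ: if θ misses the set s on a block, every v that satisfies θ on s
  -- also satisfies θ somewhere off s, so a colour χ put on all of the block outside s is read off there.
  collapse : ∀ V W p → Formula L (V ++ W) → Formula L (V ++ W) →
             Formula L (V ++ Repeat p W)
  collapse V W p θ χ =
    ¬ᶠ ⋀ (λ q → ¬ᶠ θ-at q) ∧ᶠ ⋀ (λ q → ¬ᶠ (θ-at q ∧ᶠ ¬ᶠ rename (slot V W q) χ))
    where
    θ-at : Fin p → Formula L (V ++ Repeat p W)
    θ-at q = rename (slot V W q) θ

  satisfies-collapse : ∀ V W p (θ χ : Formula L (V ++ W))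
    (v : Tuple A V) {ω : Tuple A (Repeat p W)} {w : Fin p → Tuple A W} →
    (∀ q → Restricts (component (λ _ → W) q) ω (w q)) →
    (A ⊨ collapse V W p θ χ [ ++⁺ v ω ]) ⇔
    ((∃[ q ] A ⊨ θ [ ++⁺ v (w q) ]) × (∀ q → A ⊨ θ [ ++⁺ v (w q) ] → A ⊨ χ [ ++⁺ v (w q) ]))
  satisfies-collapse V W p θ χ v {ω} {w} r = mk⇔
    (λ (some , all) →
      (stable λ none → some (from (satisfies-⋀ _) λ q t → none (q , to (at q θ) t))) ,
      (λ q t → stable λ ¬u → to (satisfies-⋀ {p} _) all q (from (at q θ) t , ¬u ∘ to (at q χ))))
    (λ ((q , t) , all) →
      (λ none → to (satisfies-⋀ {p} _) none q (from (at q θ) t)) ,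
      from (satisfies-⋀ {p} _) λ q (t , ¬u) → ¬u (from (at q χ) (all q (to (at q θ) t))))
    where
    at : ∀ q η → (A ⊨ rename (slot V W q) η [ ++⁺ v ω ]) ⇔ (A ⊨ η [ ++⁺ v (w q) ])
    at q η = satisfies-rename (slot V W q) η (restricts-slot {q = q} v (r q))

  Proper : ∀ {K} V W → (Fin K → Formula L (V ++ W)) → Set ℓ
  Proper V W θ = ∀ (v : Tuple A V) (w : Tuple A W) → ¬ (∀ c → A ⊨ θ c [ ++⁺ v w ])

  Avoidable : ∀ {K} V W → (Fin K → Formula L (V ++ W)) → ∀ {n} → (Fin n → Tuple A W) → Set ℓ
  Avoidable {K} V W θ {n} w =
    Σ[ E ∈ (Fin n → Fin K) ] ∀ (v : Tuple A V) → ¬ (∀ i → A ⊨ θ (E i) [ ++⁺ v (w i) ])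

  module Collapse {K p : ℕ} (V W : List S) (θ : Fin (suc (suc K)) → Formula L (V ++ W))
    (untraced : (w : Fin p → Tuple A W) →
                Σ[ s ∈ (Fin p → Bool) ] ∀ (v : Tuple A V) → ¬ Traces V W (θ zero) v w s) where

    θ′ : Fin (suc K) → Formula L (V ++ Repeat p W)
    θ′ c = collapse V W p (θ zero) (θ (suc c))

    -- The first new formula provides a position where `θ zero` holds. There the implications inside
    -- the new formulas give all other colours, against properness of `θ`.
    θ′-proper : Proper V W θ → Proper V (Repeat p W) θ′
    θ′-proper proper v ω h = proper v (part q) λ
      { zero    → t
      ; (suc c) → proj₂ (to (unfold c) (h c)) q t
      }
      where
      part : Fin p → Tuple A W
      part q = restrict (component (λ _ → W) q) ω
      unfold : ∀ c → (A ⊨ θ′ c [ ++⁺ v ω ]) ⇔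
               ((∃[ q ] A ⊨ θ zero [ ++⁺ v (part q) ]) ×
                (∀ q → A ⊨ θ zero [ ++⁺ v (part q) ] → A ⊨ θ (suc c) [ ++⁺ v (part q) ]))
      unfold c = satisfies-collapse V W p (θ zero) (θ (suc c)) v
                   (λ q → restricts-restrict (component (λ _ → W) q) ω)
      q = proj₁ (proj₁ (to (unfold zero) (h zero)))
      t = proj₂ (proj₁ (to (unfold zero) (h zero)))

    module _ {n : ℕ} (avoid′ : (w : Fin n → Tuple A (Repeat p W)) →
                               Avoidable V (Repeat p W) θ′ w)
             (w : Fin (n * p) → Tuple A W) where

      block : Fin n → Fin p → Tuple A W
      block k q = w (combine k q)

      s : Fin n → Fin p → Bool
      s k = proj₁ (untraced (block k))

      -- A missed set that fills its block leaves no position for another colour; but then the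
      -- constant colour `zero` is already avoided on that block.
      avoid-full : (∃[ k ] ∀ q → T (s k q)) → Avoidable V W θ w
      avoid-full (k , full) = (λ _ → zero) , λ v h →
        proj₂ (untraced (block k)) v λ q → mk⇔ (λ _ → full q) (λ _ → h (combine k q))

      module _ (outside : ∀ (k : Fin n) → Σ[ q ∈ Fin p ] ¬ T (s k q)) where

        -- Each block is padded, by repetition, to a block of p elements outside the untraced set.
        pad : ∀ k → Fin p → Fin p
        pad k q = if s k q then proj₁ (outside k) else q

        pad-outside : ∀ k q → ¬ T (s k (pad k q))
        pad-outside k q = go (s k q) refl
          where
          go : ∀ b → s k q ≡ b → ¬ T (s k (if b then proj₁ (outside k) else q))
          go true  _  = proj₂ (outside k)
          go false eq = subst T eq

        pad-fixes : ∀ k q → ¬ T (s k q) → pad k q ≡ q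
        pad-fixes k q ¬s with s k q
        ... | true  = contradiction tt ¬s
        ... | false = refl

        E′ : Fin n → Fin (suc K)
        E′ = proj₁ (avoid′ λ k → join A (block k ∘ pad k))

        colour : Fin n × Fin p → Fin (suc (suc K))
        colour (k , q) = if s k q then zero else suc (E′ k)

        module _ (v : Tuple A V)
                 (h : ∀ (i : Fin (n * p)) → A ⊨ θ (colour (remQuot p i)) [ ++⁺ v (w i) ]) where

          h′ : ∀ k q → A ⊨ θ (colour (k , q)) [ ++⁺ v (block k q) ]
          h′ k q = subst (λ kq → A ⊨ θ (colour kq) [ ++⁺ v (block k q) ])
                     (remQuot-combine k q) (h (combine k q))

          inside : ∀ k q → T (s k q) → A ⊨ θ zero [ ++⁺ v (block k q) ]
          inside k q t with s k q | h′ k q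
          ... | true | a = a

          coloured : ∀ k q → ¬ T (s k q) → A ⊨ θ (suc (E′ k)) [ ++⁺ v (block k q) ]
          coloured k q ¬t with s k q | h′ k q
          ... | true  | _ = contradiction tt ¬t
          ... | false | a = a

          -- Otherwise `θ zero` would hold exactly on the missed set: the colouring forces it
          -- inside, and the padded block covers every position outside.
          zeroOutside : ∀ k → ∃[ q ] A ⊨ θ zero [ ++⁺ v (block k (pad k q)) ]
          zeroOutside k = stable λ none → proj₂ (untraced (block k)) v λ q → mk⇔
            (λ a → stable λ ¬t → none (q ,
               subst (λ q → A ⊨ θ zero [ ++⁺ v (block k q) ]) (sym (pad-fixes k q ¬t)) a))
            (inside k q)

          -- All positions of a padded block carry the colour `suc (E′ k)`, so with `zeroOutside`
          -- the tuple `v` satisfies `θ′ (E′ k)` on every padded block, against the choice of `E′`.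
          impossible : ⊥
          impossible = proj₂ (avoid′ λ k → join A (block k ∘ pad k)) v λ k →
            from (satisfies-collapse V W p (θ zero) (θ (suc (E′ k))) v
                   (restricts-component (block k ∘ pad k)))
              (zeroOutside k , λ q _ → coloured k (pad k q) (pad-outside k q))

        avoid-outside : Avoidable V W θ w
        avoid-outside = colour ∘ remQuot p , impossible

      avoid : Avoidable V W θ w
      avoid = decide em
        where
        decide : Dec (∃[ k ] ∀ q → T (s k q)) → Avoidable V W θ w
        decide (yes full) = avoid-full full
        decide (no ¬full) = avoid-outside λ k → ¬∀⇒∃¬ λ full → ¬full (k , full)

  -- Induction on the number of colours; `W` stays general because each elimination replaces it by
  -- `p` copies of itself.
  avoidableColouring : ∀ K V W (θ : Fin (suc K) → Formula L (V ++ W)) → Proper V W θ →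
                       ∃[ n ] ∀ (w : Fin n → Tuple A W) → Avoidable V W θ w
  avoidableColouring zero V W θ proper =
    -- A single proper colour holds nowhere, so one `w` suffices.
    1 , λ w → (λ _ → zero) , λ v h → proper v (w zero) λ { zero → h zero }
  avoidableColouring (suc K) V W θ proper =
    let (p , untraced) = unshattered nip V W (θ zero)
        open Collapse V W θ untraced
        (n , avoid′)   = avoidableColouring K V (Repeat p W) θ′ (θ′-proper proper)
    in n * p , avoid avoid′

  avoidableColouring′ : ∀ {K} .{{_ : NonZero K}} V W (θ : Fin K → Formula L (V ++ W)) → Proper V W θ →
                        ∃[ n ] ∀ (w : Fin n → Tuple A W) → Avoidable V W θ w
  avoidableColouring′ {suc K} = avoidableColouring K

  -- A colour is a row pattern and a colouring a matrix; `u i` witnesses the quantifier in the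
  -- pattern of row `i`. The matrix depends on `w` alone and is fixed before `u` and `v`.
  unrealisedGrid : ∀ U V W (φ : Formula L (U ++ V ++ W)) →
    ∃[ n ] ∃[ m ] ∀ (w : Fin n → Fin m → Tuple A W) →
    Σ[ E ∈ (Fin n → Fin (2 ^ m)) ] ∀ (u : Fin n → Tuple A U) (v : Fin m → Tuple A V) →
    ¬ (∀ i j → (A ⊨ φ [ ++⁺ (u i) (++⁺ (v j) (w i j)) ]) ⇔ T (bit (E i) j))
  unrealisedGrid U V W φ =
    proj₁ avoidable , m , λ w → let (E , avoided) = proj₂ avoidable (join A ∘ w) in
      E , λ u v h → avoided (join A v) λ i →
        from (satisfies-rowPattern (E i) (restricts-component v) (restricts-component (w i))) (u i , h i)
    where
    m = proj₁ (unshattered nip U (V ++ W) φ)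
    untraced : (w : Fin m → Tuple A (V ++ W)) → ∃[ s ] ∀ v → ¬ Traces U (V ++ W) φ v w s
    untraced = proj₂ (unshattered nip U (V ++ W) φ)
    Vs = Repeat m V
    Ws = Repeat m W

    cell : Fin m → U ++ V ++ W ⊆ U ++ Vs ++ Ws
    cell j = copair {Γ = U} {V ++ W} (xs⊆xs++ys U (Vs ++ Ws))
      (xs⊆ys++xs (Vs ++ Ws) U ∘ copair {Γ = V} {W} (xs⊆xs++ys Vs Ws ∘ component (λ _ → V) j)
                                            (xs⊆ys++xs Ws Vs ∘ component (λ _ → W) j))

    rowPattern : Fin (2 ^ m) → Formula L (Vs ++ Ws)
    rowPattern c = ∃* U (⋀ λ j → literal (bit {m} c j) (rename (cell j) φ))

    satisfies-rowPattern : ∀ c {ν : Tuple A Vs} {ω : Tuple A Ws}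
      {v : Fin m → Tuple A V} {w : Fin m → Tuple A W} →
      (∀ j → Restricts (component (λ _ → V) j) ν (v j)) →
      (∀ j → Restricts (component (λ _ → W) j) ω (w j)) →
      (A ⊨ rowPattern c [ ++⁺ ν ω ]) ⇔
      (Σ[ u ∈ Tuple A U ] ∀ j → (A ⊨ φ [ ++⁺ u (++⁺ (v j) (w j)) ]) ⇔ T (bit {m} c j))
    satisfies-rowPattern c {ν} {ω} {v} {w} rv rw = mk⇔
      (λ p → let (u , q) = to (satisfies-∃* U _) p in
        u , λ j → to (satisfies-literal (bit {m} c j) _) (to (satisfies-⋀ _) q j) ⇔-∘ ⇔-sym (at u j))
      (λ (u , q) → from (satisfies-∃* U _) (u , from (satisfies-⋀ _) λ j →
        from (satisfies-literal (bit {m} c j) _) (q j ⇔-∘ at u j)))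
      where
      at : ∀ (u : Tuple A U) j →
           (A ⊨ rename (cell j) φ [ ++⁺ u (++⁺ ν ω) ]) ⇔ (A ⊨ φ [ ++⁺ u (++⁺ (v j) (w j)) ])
      at u j = satisfies-rename (cell j) φ (restricts-copair (restricts-left u _)
        (restricts-∘ (restricts-right u _) (restricts-copair
          (restricts-∘ (restricts-left ν ω) (rv j))
          (restricts-∘ (restricts-right ν ω) (rw j)))))

    -- If every pattern were realised, the realising tuples would trace all sets on the `m` pairs of
    -- `v j` and `w j`, including the missed one.
    proper : ∀ (ν : Tuple A Vs) (ω : Tuple A Ws) → ¬ (∀ c → A ⊨ rowPattern c [ ++⁺ ν ω ])
    proper ν ω h = proj₂ (untraced λ j → ++⁺ (v j) (w j)) (proj₁ realised) λ j →
      subst (λ b → (A ⊨ φ [ ++⁺ (proj₁ realised) (++⁺ (v j) (w j)) ]) ⇔ T b)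
        (bit-encode s j) (proj₂ realised j)
      where
      v : Fin m → Tuple A V
      v j = restrict (component (λ _ → V) j) ν
      w : Fin m → Tuple A W
      w j = restrict (component (λ _ → W) j) ω
      s : Fin m → Bool
      s = proj₁ (untraced λ j → ++⁺ (v j) (w j))
      realised = to (satisfies-rowPattern (encode s)
        (λ j → restricts-restrict (component (λ _ → V) j) ν)
        (λ j → restricts-restrict (component (λ _ → W) j) ω)) (h (encode s))

    instance
      2^m≢0 : NonZero (2 ^ m)
      2^m≢0 = m^n≢0 2 m

    avoidable = avoidableColouring′ Vs Ws rowPattern proper

-- Transfer of finite shattering to `M`.

module Transfer {ℓ} {S : Set ℓ} {L : Language S} (y : Fin 3 → List S) (ψ : Formula L (Joint y)) where

  y₀ y₁ y₂ : List S
  y₀ = y zero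
  y₁ = y (suc zero)
  y₂ = y (suc (suc zero))

  triple : ∀ (K : Structure L) → Tuple K y₀ → Tuple K y₁ → Tuple K y₂ → ∀ k → Tuple K (y k)
  triple K b a a′ zero             = b
  triple K b a a′ (suc zero)       = a
  triple K b a a′ (suc (suc zero)) = a′

  Realises : ∀ (K : Structure L) {n m} → (Fin n → Fin (2 ^ m)) →
             (Fin n → Tuple K y₁) → (Fin m → Tuple K y₂) → Tuple K y₀ → Set ℓ
  Realises K {m = m} E a a′ b =
    ∀ i j → (K ⊨ ψ [ join K (triple K b (a i) (a′ j)) ]) ⇔ T (bit {m} (E i) j)

  -- A finite fragment of the 2-independence property, hence expressible by a single sentence; row
  -- `i` of the matrix is `E i`.
  Shatters : Structure L → ℕ → ℕ → Set ℓ
  Shatters K n m = Σ[ a ∈ (Fin n → Tuple K y₁) ] Σ[ a′ ∈ (Fin m → Tuple K y₂) ]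
                   ∀ (E : Fin n → Fin (2 ^ m)) → Σ[ b ∈ Tuple K y₀ ] Realises K E a a′ b

  module _ (n m : ℕ) where

    -- `∃*` puts its block in front of the scope, so the block quantified last comes first, and the
    -- trailing `[]` is the scope of a sentence.
    Γ₁ Γ₂ Γ₁₂ : List S
    Γ₁ = Repeat n y₁
    Γ₂ = Repeat m y₂
    Γ₁₂ = Γ₂ ++ Γ₁ ++ []

    place : Fin n → Fin m → Joint y ⊆ y₀ ++ Γ₁₂
    place i j = copair {Γ = y₀} {y₁ ++ y₂ ++ []} (xs⊆xs++ys y₀ Γ₁₂)
      (xs⊆ys++xs Γ₁₂ y₀ ∘ copair {Γ = y₁} {y₂ ++ []}
        (xs⊆ys++xs (Γ₁ ++ []) Γ₂ ∘ xs⊆xs++ys Γ₁ [] ∘ component (λ _ → y₁) i)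
        (copair {Γ = y₂} {[]} (xs⊆xs++ys Γ₂ (Γ₁ ++ []) ∘ component (λ _ → y₂) j) λ ()))

    realised : (Fin n → Fin (2 ^ m)) → Formula L Γ₁₂
    realised E = ∃* y₀ (⋀ λ i → ⋀ λ j → literal (bit {m} (E i) j) (rename (place i j) ψ))

    shattered : Formula L Γ₁₂
    shattered = ⋀ {k = (2 ^ m) ^ n} (realised ∘ finToFun)

    shatteringSentence : Sentence L
    shatteringSentence = ∃* Γ₁ (∃* Γ₂ shattered)

    module _ (K : Structure L) where

      open Semantics K

      satisfies-realised : ∀ E {γ₁ : Tuple K Γ₁} {γ₂ : Tuple K Γ₂}
        {a : Fin n → Tuple K y₁} {a′ : Fin m → Tuple K y₂} →
        (∀ i → Restricts (component (λ _ → y₁) i) γ₁ (a i)) →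
        (∀ j → Restricts (component (λ _ → y₂) j) γ₂ (a′ j)) →
        (K ⊨ realised E [ ++⁺ γ₂ (++⁺ γ₁ []) ]) ⇔ (Σ[ b ∈ Tuple K y₀ ] Realises K E a a′ b)
      satisfies-realised E {γ₁} {γ₂} {a} {a′} r₁ r₂ = mk⇔
        (λ p → let (b , q) = to (satisfies-∃* y₀ _) p in
          b , λ i j → to (satisfies-literal (bit {m} (E i) j) _)
                        (to (satisfies-⋀ _) (to (satisfies-⋀ {n} _) q i) j) ⇔-∘ ⇔-sym (at b i j))
        (λ (b , q) → from (satisfies-∃* y₀ _) (b ,
          from (satisfies-⋀ _) λ i → from (satisfies-⋀ _) λ j →
            from (satisfies-literal (bit {m} (E i) j) _) (q i j ⇔-∘ at b i j)))
        where
        at : ∀ b i j → (K ⊨ rename (place i j) ψ [ ++⁺ b (++⁺ γ₂ (++⁺ γ₁ [])) ]) ⇔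
                       (K ⊨ ψ [ join K (triple K b (a i) (a′ j)) ])
        at b i j = satisfies-rename (place i j) ψ
          (restricts-copair (restricts-left b _) (restricts-∘ (restricts-right b _)
            (restricts-copair
              (restricts-∘ (restricts-right γ₂ _) (restricts-∘ (restricts-left γ₁ []) (r₁ i)))
              (restricts-copair (restricts-∘ (restricts-left γ₂ _) (r₂ j)) (restricts λ ())))))

      satisfies-shatteringSentence : (K ⊨ shatteringSentence [ [] ]) ⇔ Shatters K n m
      satisfies-shatteringSentence = mk⇔ shatters satisfied
        where
        shatters : K ⊨ shatteringSentence [ [] ] → Shatters K n m
        shatters p =
          let (γ₁ , p₁) = to (satisfies-∃* Γ₁ (∃* Γ₂ shattered)) p
              (γ₂ , p₂) = to (satisfies-∃* Γ₂ shattered) p₁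
              a : Fin n → Tuple K y₁
              a i = restrict (component (λ _ → y₁) i) γ₁
              a′ : Fin m → Tuple K y₂
              a′ j = restrict (component (λ _ → y₂) j) γ₂
          in a , a′ , λ E →
            let (b , q) = to (satisfies-realised (finToFun (funToFin E))
                               (λ i → restricts-restrict (component (λ _ → y₁) i) γ₁)
                               (λ j → restricts-restrict (component (λ _ → y₂) j) γ₂))
                             (to (satisfies-⋀ (realised ∘ finToFun)) p₂ (funToFin E))
            in b , λ i j → subst
                 (λ c → (K ⊨ ψ [ join K (triple K b (a i) (a′ j)) ]) ⇔ T (bit {m} c j))
                 (finToFun-funToFin E i) (q i j)

        satisfied : Shatters K n m → K ⊨ shatteringSentence [ [] ]
        satisfied (a , a′ , h) =
          from (satisfies-∃* Γ₁ (∃* Γ₂ shattered)) (join K a ,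
            from (satisfies-∃* Γ₂ shattered) (join K a′ ,
              from (satisfies-⋀ (realised ∘ finToFun)) λ e →
                from (satisfies-realised (finToFun e) (restricts-component a) (restricts-component a′))
                  (h (finToFun e))))

  IP⇒shatters : ∀ {T} → HasIP 2 T y₀ (y ∘ suc) ψ → ∀ n m → Σ[ N ∈ Structure L ] (N ⊨ᵀ T) × Shatters N n m
  IP⇒shatters (N , N⊨T , a , realise) n m =
    N , N⊨T , (λ i → a (toℕ i) zero) , (λ j → a (toℕ j) (suc zero)) , λ E →
      proj₁ (realise (Pattern E)) , λ i j →
        mk⇔ (decode E i j) (λ t → i , j , refl , refl , t)
        ⇔-∘ proj₂ (realise (Pattern E)) (toℕ i ∷ toℕ j ∷ [])
    where
    Pattern : (Fin n → Fin (2 ^ m)) → Pred (Vec ℕ 2) 0ℓ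
    -- The finite matrix is extended to all of ω² by leaving out every point off the grid.
    Pattern E (k ∷ l ∷ []) = ∃[ i ] ∃[ j ] toℕ i ≡ k × toℕ j ≡ l × T (bit {m} (E i) j)

    decode : ∀ E i j → Pattern E (toℕ i ∷ toℕ j ∷ []) → T (bit {m} (E i) j)
    decode E i j (i′ , j′ , p , q , t) with toℕ-injective p | toℕ-injective q
    ... | refl | refl = t

  -- `Th M` is complete: if the sentence failed in `M`, its negation would belong to `Th M` and hold
  -- in the model that shatters.
  IP-transfers : (∀ {a} → ExcludedMiddle a) → ∀ M → HasIP 2 (Th M) y₀ (y ∘ suc) ψ →
                 ∀ n m → Shatters M n m
  IP-transfers em M ip n m =
    let (N , N⊨ThM , shatters) = IP⇒shatters ip n m
    in to (satisfies-shatteringSentence n m M) (Classical.stable em λ ¬σ →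
         N⊨ThM (¬ᶠ shatteringSentence n m) ¬σ (from (satisfies-shatteringSentence n m N) shatters))

-- The formula with the functions substituted.

module Substitution {ℓ} {S : Set ℓ} {L₀ L : Language S} (ι : L₀ ⊆ᴸ L) (M : Structure L)
    {d m : ℕ} (x : Fin d → List S) (y : Fin m → List S) (s t : Fin d → Fin m)
    (f : ∀ i → DefinableFunction M (y (s i)) (y (t i)) (x i)) where

  open Semantics M

  values : (∀ k → Tuple M (y k)) → ∀ i → Tuple M (x i)
  values τ i = apply (f i) (τ (s i)) (τ (t i))

  -- The graphs pin the quantified tuple to the values of the functions. This is an argument in `M`,
  -- where `defines` applies, which is why shattering is first transferred there.
  satisfies-substitute : ∀ (φ : Formula L₀ (Joint x)) τ →
    (M ⊨ substitute ι M x y s t φ f [ join M τ ]) ⇔ (reduct ι M ⊨ φ [ join M (values τ) ])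
  satisfies-substitute φ τ = mk⇔
    (λ p →
      let (ξ , q)      = to (satisfies-∃* (Joint x) _) p
          (graphs , r) = to (satisfies-foldr {d} _ _) q
          part         = λ i → restricts-restrict (component x i) ξ
          equals : ∀ i → Structure._≋_ M (values τ i) (restrict (component x i) ξ)
          equals i     = to (defines (f i) (τ (s i)) (τ (t i)) (restrict (component x i) ξ))
                            (to (graph-at i (part i)) (graphs i))
      in to (satisfies-map ι inX φ (restricts-join inX (values τ) λ i →
               restricts-≋ (restricts-∘ (restricts-left ξ (join M τ)) (part i)) (equals i))) r)
    (λ p → from (satisfies-∃* (Joint x) _) (join M (values τ) ,
      from (satisfies-foldr {d} _ _)
        ((λ i → from (graph-at i (restricts-component (values τ) i))
                  (from (defines (f i) (τ (s i)) (τ (t i)) (values τ i)) λ _ → ≈.refl)) ,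
         from (satisfies-map ι inX φ (restricts-left (join M (values τ)) (join M τ))) p)))
    where
    inX : Joint x ⊆ Joint x ++ Joint y
    inX = xs⊆xs++ys (Joint x) (Joint y)
    inY : Joint y ⊆ Joint x ++ Joint y
    inY = xs⊆ys++xs (Joint y) (Joint x)

    restricts-≋ : ∀ {Γ Δ} {ρ : Δ ⊆ Γ} {γ δ δ′} → Restricts ρ γ δ → Structure._≋_ M δ′ δ → Restricts ρ γ δ′
    restricts-≋ (restricts r) e = restricts λ v → ≈.trans (r v) (≈.sym (e v))

    graph-at : ∀ i {ξ : Tuple M (Joint x)} {c : Tuple M (x i)} → Restricts (component x i) ξ c →
      (M ⊨ rename (copair {Γ = y (s i)} (inY ∘ component y (s i))
                    (copair {Γ = y (t i)} {x i} (inY ∘ component y (t i)) (inX ∘ component x i)))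
             (graph (f i)) [ ++⁺ ξ (join M τ) ]) ⇔
      (M ⊨ graph (f i) [ ++⁺ (τ (s i)) (++⁺ (τ (t i)) c) ])
    graph-at i {ξ} r = satisfies-rename _ (graph (f i))
      (restricts-copair (restricts-∘ (restricts-right ξ (join M τ)) (restricts-component τ (s i)))
        (restricts-copair (restricts-∘ (restricts-right ξ (join M τ)) (restricts-component τ (t i)))
          (restricts-∘ (restricts-left ξ (join M τ)) r)))

-- Separating the three pairs of arguments.

module Separation {ℓ} {S : Set ℓ} {L₀ L : Language S} (ι : L₀ ⊆ᴸ L) (M : Structure L)
    {d : ℕ} (x : Fin d → List S) (y : Fin 3 → List S) (s t : Fin d → Fin 3) (s<t : ∀ i → s i < t i)
    (φ : Formula L₀ (Joint x))
    (f : ∀ i → DefinableFunction M (y (s i)) (y (t i)) (x i)) where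

  open Semantics M
  open Substitution ι M x y s t f
  open Transfer y (substitute ι M x y s t φ f)

  X : List S
  X = Joint x

  -- For `p < q`, the second index being `suc zero` forces the pair {1, 2}, and the last clause is
  -- reached by {2, 3} alone.
  copy : Fin 3 → Fin 3 → X ⊆ X ++ X ++ X
  copy _    (suc zero)       = xs⊆xs++ys X (X ++ X)
  copy zero (suc (suc zero)) = xs⊆ys++xs (X ++ X) X ∘ xs⊆xs++ys X X
  copy _    _                = xs⊆ys++xs (X ++ X) X ∘ xs⊆ys++xs X X

  -- Turns `φ` into the ternary formula to which `unrealisedGrid` applies, each block of variables
  -- being fed from only two of the three arguments.
  separate : X ⊆ X ++ X ++ X
  separate v = copy (s (proj₁ (locate x v))) (t (proj₁ (locate x v))) v

  value : Tuple M y₀ → Tuple M y₁ → Tuple M y₂ → Tuple M X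
  value b a a′ = join M (values (triple M b a a′))

  -- The variables xᵢ with {sᵢ, tᵢ} = {1, 2}, {1, 3}, {2, 3} go to the first, second, third copy,
  -- where the argument that fᵢ does not see is replaced by a constant.
  restricts-separate : ∀ b b₀ a a₀ a′ a₀′ →
    Restricts separate (++⁺ (value b a a₀′) (++⁺ (value b a₀ a′) (value b₀ a a′))) (value b a a′)
  restricts-separate b b₀ a a₀ a′ a₀′ = restricts local
    where
    τ = triple M b a a′
    γ = ++⁺ (value b a a₀′) (++⁺ (value b a₀ a′) (value b₀ a a′))

    source : Fin 3 → Fin 3 → ∀ k → Tuple M (y k)
    source _    (suc zero)       = triple M b a a₀′
    source zero (suc (suc zero)) = triple M b a₀ a′
    source _    _                = triple M b₀ a a′

    source-fst : ∀ p q → p < q → source p q p ≡ τ p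
    source-fst zero       (suc zero)       _ = refl
    source-fst zero       (suc (suc zero)) _ = refl
    source-fst (suc zero) (suc (suc zero)) _ = refl
    source-fst (suc zero) (suc zero) (s≤s ())
    source-fst (suc (suc zero)) (suc zero) (s≤s ())
    source-fst (suc (suc zero)) (suc (suc zero)) (s≤s (s≤s ()))

    source-snd : ∀ p q → p < q → source p q q ≡ τ q
    source-snd zero       (suc zero)       _ = refl
    source-snd zero       (suc (suc zero)) _ = refl
    source-snd (suc zero) (suc (suc zero)) _ = refl
    source-snd (suc zero) (suc zero) (s≤s ())
    source-snd (suc (suc zero)) (suc zero) (s≤s ())
    source-snd (suc (suc zero)) (suc (suc zero)) (s≤s (s≤s ()))

    restricts-third : Restricts (xs⊆ys++xs (X ++ X) X ∘ xs⊆ys++xs X X) γ (value b₀ a a′)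
    restricts-third = restricts-∘ (restricts-right (value b a a₀′) _) (restricts-right (value b a₀ a′) _)

    restricts-copy : ∀ p q → Restricts (copy p q) γ (join M (values (source p q)))
    restricts-copy zero             zero             = restricts-third
    restricts-copy (suc _)          zero             = restricts-third
    restricts-copy zero             (suc zero)       = restricts-left (value b a a₀′) _
    restricts-copy (suc _)          (suc zero)       = restricts-left (value b a a₀′) _
    restricts-copy zero             (suc (suc zero)) =
      restricts-∘ (restricts-right (value b a a₀′) _) (restricts-left (value b a₀ a′) _)
    restricts-copy (suc _)          (suc (suc zero)) = restricts-third

    values-source : ∀ i → values (source (s i) (t i)) i ≡ values τ i
    values-source i = cong₂ (apply (f i)) (source-fst (s i) (t i) (s<t i)) (source-snd (s i) (t i) (s<t i))

    local : ∀ {r} (v : r ∈ X) → lookup γ (separate v) ≈ lookup (value b a a′) v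
    local v with locate x v
    ... | i , u , refl =
      ≈.trans (Restricts.agree (restricts-copy (s i) (t i)) (component x i u))
      (≈.trans (Restricts.agree (restricts-component (values (source (s i) (t i))) i) u)
      (≈.trans (≈.reflexive (cong (λ c → lookup c u) (values-source i)))
               (≈.sym (Restricts.agree (restricts-component (values τ) i) u))))

  satisfies-separate : ∀ b b₀ a a₀ a′ a₀′ →
    (reduct ι M ⊨ rename separate φ [ ++⁺ (value b a a₀′) (++⁺ (value b a₀ a′) (value b₀ a a′)) ]) ⇔
    (M ⊨ substitute ι M x y s t φ f [ join M (triple M b a a′) ])
  satisfies-separate b b₀ a a₀ a′ a₀′ =
    ⇔-sym (satisfies-substitute φ (triple M b a a′))
    ⇔-∘ Semantics.satisfies-rename (reduct ι M) separate φ
          (Semantics.restricts (Restricts.agree (restricts-separate b b₀ a a₀ a′ a₀′)))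

  unshatterable : ∀ {n m} →
    (∀ (w : Fin n → Fin m → Tuple M X) →
      Σ[ E ∈ (Fin n → Fin (2 ^ m)) ] ∀ (u : Fin n → Tuple M X) (v : Fin m → Tuple M X) →
      ¬ (∀ i j → (reduct ι M ⊨ rename separate φ [ ++⁺ (u i) (++⁺ (v j) (w i j)) ]) ⇔
                 T (bit {m} (E i) j))) →
    Shatters M 1 1 → ¬ Shatters M n m
  unshatterable unrealised (a₀ , a₀′ , single) (a , a′ , shattered) =
    proj₂ (unrealised w) (λ i → value b (a i) (a₀′ zero)) (λ j → value b (a₀ zero) (a′ j))
      λ i j → proj₂ (shattered (proj₁ (unrealised w))) i j
        ⇔-∘ satisfies-separate b b₀ (a i) (a₀ zero) (a′ j) (a₀′ zero)
    where
    -- The tuple `b` is found only after the matrix, which depends on `w`; so `w` is built with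
    -- another tuple `b₀`. Like `a₀` and `a₀′`, it comes from a shattered `1 × 1` grid, which
    -- guarantees that such points exist.
    b₀ = proj₁ (single λ _ → zero)
    w = λ i j → value b₀ (a i) (a′ j)
    b = proj₁ (shattered (proj₁ (unrealised w)))

  twoDependent : (∀ {a} → ExcludedMiddle a) → (∀ {a b} → Extensionality a b) →
    IsDependent (reduct ι M) →
    IsDependentFormula 2 (Th M) y₀ (y ∘ suc) (substitute ι M x y s t φ f)
  twoDependent em ext nip ip =
    -- Dependence is applied to a formula of `L₀`; the functions definable in `L` enter only through
    -- the points at which it is evaluated.
    let (n , m , unrealised) = Dependent.unrealisedGrid em ext (reduct ι M) nip X X X (rename separate φ)
    in unshatterable unrealised (IP-transfers em M ip 1 1) (IP-transfers em M ip n m)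

theorem5p12 :
    (∀ {a} → ExcludedMiddle a) → (∀ {a b} → Extensionality a b) →
    ∀ {ℓ} {S : Set ℓ} {L₀ L : Language S} (ι : L₀ ⊆ᴸ L)
    (M₀ : Structure L₀) → IsDependent M₀ →
    (M : Structure L) → IsExpansion ι M M₀ →
    ∀ {d} (x : Fin d → List S) (φ : Formula L₀ (Joint x))
    (y : Fin 3 → List S) (s t : Fin d → Fin 3) → (∀ i → s i < t i) →
    (f : ∀ i → DefinableFunction M (y (s i)) (y (t i)) (x i)) →
    IsDependentFormula 2 (Th M) (y zero) (y ∘ suc) (substitute ι M x y s t φ f)
theorem5p12 em ext ι _ nip M refl x φ y s t s<t f =
  Separation.twoDependent ι M x y s t s<t φ f em ext nip
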